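{- Let $\frac{1}{15}\le\varepsilon<\frac{2}{3}$, and let $G$ be a 3-uniform hypergraph with vertex set $V$ and $m$ edges such that there is no partition of $V$ into three $\varepsilon$-good sets. Then there is a partition $V=A\cup B\cup C$ such that $A$ and $B$ are minimal $\varepsilon$-good sets and $$d(A)+d(B)+d(C)>(2+3\varepsilon)m.$$
   Context: A 3-uniform hypergraph has a finite vertex set $V$ and $m$ edges, each a distinct 3-element subset of $V$. For $A\subseteq V$, $d(A)$ denotes the number of edges meeting $A$ (i.e. having nonempty intersection with $A$). For $0<\varepsilon<\frac23$, a set $A\subseteq V$ is $\varepsilon$-good if $d(A)\ge\left(\frac{2}{3}-\varepsilon\right)m$, and $\varepsilon$-bad otherwise; it is minimal $\varepsilon$-good if it is $\varepsilon$-good and every proper subset of it is $\varepsilon$-bad. A partition of $V$ into three sets is an ordered triple of pairwise disjoint sets whose union is $V$.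
   Formalization: The parameter ε is taken to be a rational number with 1/15 ≤ ε < 2/3, rather than an arbitrary real number in that range. -}

module Defs where

open import Data.Nat using (ℕ)
open import Data.Integer using (+_)
open import Data.Rational using (ℚ; _/_; _*_; _-_; _+_; _≤_; _<_)
open import Data.List using (List; length; filter)
open import Data.List.Relation.Unary.All using (All)
open import Data.List.Relation.Unary.Unique.Propositional using (Unique)
open import Data.Fin.Subset using (Subset; ∣_∣; _∩_; _∪_; _⊂_; ⊥; ⊤)
open import Data.Fin.Subset.Properties using (nonempty?)
open import Data.Product using (_×_)
open import Relation.Nullary using (¬_)
open import Relation.Binary.PropositionalEquality using (_≡_)

record Hypergraph (n : ℕ) : Set where
  field
    edges    : List (Subset n)
    uniform3 : All (λ e → ∣ e ∣ ≡ 3) edges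
    distinct : Unique edges

open Hypergraph public

m : ∀ {n} → Hypergraph n → ℕ
m H = length (edges H)

d : ∀ {n} → Hypergraph n → Subset n → ℕ
d H A = length (filter (λ e → nonempty? (e ∩ A)) (edges H))

ℕ→ℚ : ℕ → ℚ
ℕ→ℚ k = + k / 1

Good : ∀ {n} → Hypergraph n → ℚ → Subset n → Set
Good H ε A = ((+ 2 / 3) - ε) * ℕ→ℚ (m H) ≤ ℕ→ℚ (d H A)

Bad : ∀ {n} → Hypergraph n → ℚ → Subset n → Set
Bad H ε A = ¬ Good H ε A

MinimalGood : ∀ {n} → Hypergraph n → ℚ → Subset n → Set
MinimalGood {n} H ε A = Good H ε A × (∀ (B : Subset n) → B ⊂ A → Bad H ε B)

IsPartition : ∀ {n} → Subset n → Subset n → Subset n → Set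
IsPartition A B C =
  (A ∩ B ≡ ⊥) × (A ∩ C ≡ ⊥) × (B ∩ C ≡ ⊥) × (A ∪ B ∪ C ≡ ⊤)

{-# OPTIONS --safe #-}

-- Call a partition with bad part C stable if moving a vertex from A or B into C
-- never increases S = d(A) + d(B) + d(C).  Summing the stability inequalities over
-- A ∪ B and counting edge by edge gives 4m ≤ S + 3 d(C), hence S > (2 + 3ε)m; as
-- ε ≥ 1/15, a second bad part would force S < (2 + 3ε)m, so A and B are good.
-- Hill climbing on S reaches a stable partition.  Stability survives moving
-- vertices from A and B into C: the loss of a vertex that stays only grows and
-- its gain only shrinks.  So A and B may be cut down to minimal good sets, and C
-- remains bad since there is no partition into three good sets.
module Submission where

open import Defs
open import Data.Nat using (ℕ)
open import Data.Integer using (+_)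
open import Data.Rational using (ℚ; _/_; _*_; _+_; _≤_; _<_)
open import Data.Fin.Subset using (Subset)
open import Data.Product using (_×_; ∃-syntax)
open import Relation.Nullary using (¬_)

open import Data.Bool using (true; false; if_then_else_)
open import Data.Fin using (Fin; zero; suc)
open import Data.Fin.Properties using (any?)
open import Data.Fin.Subset
  using (∣_∣; _∩_; _⊆_; _⊂_; _∈_; _∉_; inside; outside; ⊥; ⊤)
open import Data.Fin.Subset.Properties
  using (nonempty?; anySubset?; _⊂?_; _∈?_; drop-∷-⊆; s⊆s; out⊆; ⊆-refl; ⊆-trans;
         p⊆q⇒∣p∣≤∣q∣; p⊂q⇒∣p∣<∣q∣; x∈p∩q⁺; x∈p∩q⁻; Empty-unique; ∣⊥∣≡0; ∣p∣≤∣x∷p∣)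
import Data.Integer as ℤ
import Data.Integer.Properties as ℤ
open import Data.List using (List; []; _∷_; length; map; filter)
open import Data.List.Properties using (length-filter)
open import Data.List.Relation.Unary.All as All using (All; []; _∷_)
import Data.Nat as ℕ
open import Data.Nat using (zero; suc; z≤n; s≤s)
open import Data.Nat.Induction using (Acc; acc; <-wellFounded)
open import Data.Nat.ListAction using (sum)
import Data.Nat.Properties as ℕ
open import Data.Nat.Solver using (module +-*-Solver)
open import Data.Product using (_,_; proj₁)
open import Data.Rational using (_-_; -_; *≤*; nonNegative)
open import Data.Rational.Literals using (fromℤ)
import Data.Rational.Properties as ℚ
import Data.Rational.Solver as ℚ
open import Data.Sum using (_⊎_; inj₁; inj₂)
open import Data.Vec using ([]; _∷_; lookup; _[_]≔_; here; there)
open import Data.Vec.Properties using (lookup⇒[]=)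
open import Function using (_∘_)
open import Relation.Binary.PropositionalEquality
  using (_≡_; refl; sym; trans; cong; cong₂; subst; subst₂; module ≡-Reasoning)
open import Relation.Nullary using (yes; no; contradiction; _×-dec_)
open import Relation.Unary using (Decidable)

private
  variable
    n : ℕ
    A B C : Subset n
    v : Fin n

-- Intersection sizes and their change when one vertex moves

-- Meant for `∣ e ∩ X ∣`: `pos` tells whether `e` counts in `d H X`, `one` whether `e` hangs on a
-- single vertex of `X`, `null` whether it still waits for its first.
pos one null : ℕ → ℕ
pos zero    = 0
pos (suc _) = 1
one 1 = 1
one _ = 0
null zero    = 1
null (suc _) = 0

-- `one` climbs from 0 to 1 before it falls, so the smaller argument has to be positive; in
-- `loss-antitone` the vertex that stays provides this.
one-antitone : ∀ {i j} → 0 ℕ.< i → i ℕ.≤ j → one j ℕ.≤ one i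
one-antitone {j = 1} (s≤s z≤n) (s≤s z≤n) = ℕ.≤-refl
one-antitone {j = suc (suc _)} _ _ = z≤n

null-antitone : ∀ {i j} → i ℕ.≤ j → null j ℕ.≤ null i
null-antitone {zero}  {zero}  _       = ℕ.≤-refl
null-antitone {zero}  {suc _} _       = z≤n
null-antitone {suc _} {suc _} (s≤s _) = z≤n

χ : Subset n → Fin n → ℕ
χ e v = if lookup e v then 1 else 0

-- Adding `v` changes `pos` only when the count goes from 0 to 1. Here this is read off the count
-- with `v`, in `pos-χ+≡null` off the count without it: the first fits a removal, the second an
-- insertion.
pos-χ+≡one : ∀ (e : Subset n) v i → pos (χ e v ℕ.+ i) ≡ χ e v ℕ.* one (χ e v ℕ.+ i) ℕ.+ pos i
pos-χ+≡one e v i with lookup e v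
pos-χ+≡one e v zero    | true  = refl
pos-χ+≡one e v (suc i) | true  = refl
pos-χ+≡one e v i       | false = refl

pos-χ+≡null : ∀ (e : Subset n) v i → pos (χ e v ℕ.+ i) ≡ χ e v ℕ.* null i ℕ.+ pos i
pos-χ+≡null e v i with lookup e v
pos-χ+≡null e v zero    | true  = refl
pos-χ+≡null e v (suc i) | true  = refl
pos-χ+≡null e v i       | false = refl

∣∩∣-remove : ∀ (e : Subset n) → v ∈ A → ∣ e ∩ A ∣ ≡ χ e v ℕ.+ ∣ e ∩ (A [ v ]≔ outside) ∣
∣∩∣-remove (true  ∷ e) here = refl
∣∩∣-remove (false ∷ e) here = refl
∣∩∣-remove {v = suc v} {A = true ∷ _} (true ∷ e) (there v∈A) =
  trans (cong suc (∣∩∣-remove e v∈A)) (sym (ℕ.+-suc (χ e v) _))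
∣∩∣-remove {A = false ∷ _} (true ∷ e) (there v∈A) = ∣∩∣-remove e v∈A
∣∩∣-remove (false ∷ e) (there v∈A) = ∣∩∣-remove e v∈A

∣∩∣-insert : ∀ (e : Subset n) → v ∉ C → ∣ e ∩ (C [ v ]≔ inside) ∣ ≡ χ e v ℕ.+ ∣ e ∩ C ∣
∣∩∣-insert {v = zero} {C = true ∷ _} e v∉C = contradiction here v∉C
∣∩∣-insert {v = zero} {C = false ∷ _} (true  ∷ e) v∉C = refl
∣∩∣-insert {v = zero} {C = false ∷ _} (false ∷ e) v∉C = refl
∣∩∣-insert {v = suc v} {C = true ∷ _} (true ∷ e) v∉C =
  trans (cong suc (∣∩∣-insert e (v∉C ∘ there))) (sym (ℕ.+-suc (χ e v) _))
∣∩∣-insert {v = suc v} {C = false ∷ _} (true ∷ e) v∉C = ∣∩∣-insert e (v∉C ∘ there)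
∣∩∣-insert {v = suc v} {C = _ ∷ _} (false ∷ e) v∉C = ∣∩∣-insert e (v∉C ∘ there)

∈⇒0<∣∣ : v ∈ A → 0 ℕ.< ∣ A ∣
∈⇒0<∣∣ here = s≤s z≤n
∈⇒0<∣∣ {A = x ∷ A} (there v∈A) = ℕ.≤-trans (∈⇒0<∣∣ v∈A) (∣p∣≤∣x∷p∣ x A)

∩-monoʳ-⊆ : ∀ (e : Subset n) → A ⊆ B → e ∩ A ⊆ e ∩ B
∩-monoʳ-⊆ e A⊆B v∈ = let v∈e , v∈A = x∈p∩q⁻ e _ v∈ in x∈p∩q⁺ (v∈e , A⊆B v∈A)

-- An exhaustive search either finds no proper subset with `P`, or finds one from which to continue;
-- cardinality drops each time.
∃-minimal : ∀ {p} {P : Subset n → Set p} → Decidable P → ∀ A → P A →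
  ∃[ A′ ] (A′ ⊆ A × P A′ × (∀ B → B ⊂ A′ → ¬ P B))
∃-minimal {P = P} P? A = go A (<-wellFounded ∣ A ∣)
  where
  go : ∀ A → Acc ℕ._<_ ∣ A ∣ → P A → ∃[ A′ ] (A′ ⊆ A × P A′ × (∀ B → B ⊂ A′ → ¬ P B))
  go A (acc rec) PA with anySubset? (λ B → B ⊂? A ×-dec P? B)
  ... | no ∄B = A , ⊆-refl , PA , λ B B⊂A PB → ∄B (B , B⊂A , PB)
  ... | yes (B , B⊂A , PB) =
    let A′ , A′⊆B , min = go B (rec (p⊂q⇒∣p∣<∣q∣ B⊂A)) PB
    in  A′ , ⊆-trans A′⊆B (proj₁ B⊂A) , min

-- Partitions: permuting parts, moving a vertex, shrinking

-- IsPartition, vertex by vertex.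
data Partition : Subset n → Subset n → Subset n → Set where
  []  : Partition [] [] []
  inA : Partition A B C → Partition (inside  ∷ A) (outside ∷ B) (outside ∷ C)
  inB : Partition A B C → Partition (outside ∷ A) (inside  ∷ B) (outside ∷ C)
  inC : Partition A B C → Partition (outside ∷ A) (outside ∷ B) (inside  ∷ C)

Partition⇒IsPartition : Partition A B C → IsPartition A B C
Partition⇒IsPartition [] = refl , refl , refl , refl
Partition⇒IsPartition (inA π) = let p , q , r , s = Partition⇒IsPartition π in
  cong (outside ∷_) p , cong (outside ∷_) q , cong (outside ∷_) r , cong (inside ∷_) s
Partition⇒IsPartition (inB π) = let p , q , r , s = Partition⇒IsPartition π in
  cong (outside ∷_) p , cong (outside ∷_) q , cong (outside ∷_) r , cong (inside ∷_) s
Partition⇒IsPartition (inC π) = let p , q , r , s = Partition⇒IsPartition π in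
  cong (outside ∷_) p , cong (outside ∷_) q , cong (outside ∷_) r , cong (inside ∷_) s

swap₁₂ : Partition A B C → Partition B A C
swap₁₂ []      = []
swap₁₂ (inA π) = inB (swap₁₂ π)
swap₁₂ (inB π) = inA (swap₁₂ π)
swap₁₂ (inC π) = inC (swap₁₂ π)

swap₂₃ : Partition A B C → Partition A C B
swap₂₃ []      = []
swap₂₃ (inA π) = inA (swap₂₃ π)
swap₂₃ (inB π) = inC (swap₂₃ π)
swap₂₃ (inC π) = inB (swap₂₃ π)

trivialPartition : ∀ n → Partition {n} ⊤ ⊥ ⊥
trivialPartition zero    = []
trivialPartition (suc n) = inA (trivialPartition n)

disjoint₁₃ : Partition A B C → v ∈ A → v ∉ C
disjoint₁₃ (inA π) (there v∈A) (there v∈C) = disjoint₁₃ π v∈A v∈C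
disjoint₁₃ (inB π) (there v∈A) (there v∈C) = disjoint₁₃ π v∈A v∈C
disjoint₁₃ (inC π) (there v∈A) (there v∈C) = disjoint₁₃ π v∈A v∈C

move₁₃ : Partition A B C → v ∈ A → Partition (A [ v ]≔ outside) B (C [ v ]≔ inside)
move₁₃ (inA π) here        = inC π
move₁₃ (inA π) (there v∈A) = inA (move₁₃ π v∈A)
move₁₃ (inB π) (there v∈A) = inB (move₁₃ π v∈A)
move₁₃ (inC π) (there v∈A) = inC (move₁₃ π v∈A)

-- `C′` takes up the vertices that `A` and `B` give away. The refuted cases are those where `A′` or
-- `B′` would claim a vertex it did not own.
shrink : ∀ {A′ B′ : Subset n} → Partition A B C → A′ ⊆ A → B′ ⊆ B →
  ∃[ C′ ] (C ⊆ C′ × Partition A′ B′ C′)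
shrink {A′ = []} {[]} [] _ _ = [] , (λ ()) , []
shrink {B′ = true ∷ _} (inA _) _ B′⊆B = contradiction (B′⊆B here) λ ()
shrink {A′ = true ∷ _} {false ∷ _} (inA π) A′⊆A B′⊆B =
  let C′ , C⊆C′ , π′ = shrink π (drop-∷-⊆ A′⊆A) (drop-∷-⊆ B′⊆B)
  in  outside ∷ C′ , s⊆s C⊆C′ , inA π′
shrink {A′ = false ∷ _} {false ∷ _} (inA π) A′⊆A B′⊆B =
  let C′ , C⊆C′ , π′ = shrink π (drop-∷-⊆ A′⊆A) (drop-∷-⊆ B′⊆B)
  in  inside ∷ C′ , out⊆ C⊆C′ , inC π′
shrink {A′ = true ∷ _} (inB _) A′⊆A _ = contradiction (A′⊆A here) λ ()
shrink {A′ = false ∷ _} {true ∷ _} (inB π) A′⊆A B′⊆B =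
  let C′ , C⊆C′ , π′ = shrink π (drop-∷-⊆ A′⊆A) (drop-∷-⊆ B′⊆B)
  in  outside ∷ C′ , s⊆s C⊆C′ , inB π′
shrink {A′ = false ∷ _} {false ∷ _} (inB π) A′⊆A B′⊆B =
  let C′ , C⊆C′ , π′ = shrink π (drop-∷-⊆ A′⊆A) (drop-∷-⊆ B′⊆B)
  in  inside ∷ C′ , out⊆ C⊆C′ , inC π′
shrink {A′ = true ∷ _} (inC _) A′⊆A _ = contradiction (A′⊆A here) λ ()
shrink {A′ = false ∷ _} {true ∷ _} (inC _) _ B′⊆B = contradiction (B′⊆B here) λ ()
shrink {A′ = false ∷ _} {false ∷ _} (inC π) A′⊆A B′⊆B =
  let C′ , C⊆C′ , π′ = shrink π (drop-∷-⊆ A′⊆A) (drop-∷-⊆ B′⊆B)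
  in  inside ∷ C′ , s⊆s C⊆C′ , inC π′

∣∩∣-partition : ∀ (e : Subset n) → Partition A B C →
  ∣ e ∩ C ∣ ℕ.+ (∣ e ∩ A ∣ ℕ.+ ∣ e ∩ B ∣) ≡ ∣ e ∣
∣∩∣-partition [] [] = refl
∣∩∣-partition (false ∷ e) (inA π) = ∣∩∣-partition e π
∣∩∣-partition (false ∷ e) (inB π) = ∣∩∣-partition e π
∣∩∣-partition (false ∷ e) (inC π) = ∣∩∣-partition e π
∣∩∣-partition (true ∷ e) (inA π) = trans (ℕ.+-suc _ _) (cong suc (∣∩∣-partition e π))
∣∩∣-partition {C = _ ∷ C} (true ∷ e) (inB π) =
  trans (cong (∣ e ∩ C ∣ ℕ.+_) (ℕ.+-suc _ _)) (trans (ℕ.+-suc _ _) (cong suc (∣∩∣-partition e π)))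
∣∩∣-partition (true ∷ e) (inC π) = cong suc (∣∩∣-partition e π)

-- Finite sums and double counting

∑ : ∀ {a} {X : Set a} → List X → (X → ℕ) → ℕ
∑ xs f = sum (map f xs)

module _ {a} {X : Set a} where

  ∑-cong : ∀ (xs : List X) {f g : X → ℕ} → (∀ x → f x ≡ g x) → ∑ xs f ≡ ∑ xs g
  ∑-cong []       f≗g = refl
  ∑-cong (x ∷ xs) f≗g = cong₂ ℕ._+_ (f≗g x) (∑-cong xs f≗g)

  ∑-mono : ∀ {xs : List X} {f g : X → ℕ} → All (λ x → f x ℕ.≤ g x) xs → ∑ xs f ℕ.≤ ∑ xs g
  ∑-mono []           = z≤n
  ∑-mono (fx≤gx ∷ ps) = ℕ.+-mono-≤ fx≤gx (∑-mono ps)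

  ∑-const : ∀ (xs : List X) k → ∑ xs (λ _ → k) ≡ k ℕ.* length xs
  ∑-const []       k = sym (ℕ.*-zeroʳ k)
  ∑-const (x ∷ xs) k = trans (cong (k ℕ.+_) (∑-const xs k)) (sym (ℕ.*-suc k (length xs)))

  ∑-+ : ∀ (xs : List X) f g → ∑ xs (λ x → f x ℕ.+ g x) ≡ ∑ xs f ℕ.+ ∑ xs g
  ∑-+ []       f g = refl
  ∑-+ (x ∷ xs) f g = trans (cong (f x ℕ.+ g x ℕ.+_) (∑-+ xs f g))
    (solve 4 (λ p q r s → p :+ q :+ (r :+ s) := p :+ r :+ (q :+ s)) refl (f x) (g x) (∑ xs f) (∑ xs g))
    where open +-*-Solver

  ∑-* : ∀ (xs : List X) k f → ∑ xs (λ x → k ℕ.* f x) ≡ k ℕ.* ∑ xs f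
  ∑-* []       k f = sym (ℕ.*-zeroʳ k)
  ∑-* (x ∷ xs) k f = trans (cong (k ℕ.* f x ℕ.+_) (∑-* xs k f)) (sym (ℕ.*-distribˡ-+ k (f x) _))

∑∈ : Subset n → (Fin n → ℕ) → ℕ
∑∈ []            f = 0
∑∈ (inside  ∷ A) f = f zero ℕ.+ ∑∈ A (f ∘ suc)
∑∈ (outside ∷ A) f = ∑∈ A (f ∘ suc)

∑∈-mono : ∀ (A : Subset n) {f g} → (∀ {v} → v ∈ A → f v ℕ.≤ g v) → ∑∈ A f ℕ.≤ ∑∈ A g
∑∈-mono []            f≤g = z≤n
∑∈-mono (inside  ∷ A) f≤g = ℕ.+-mono-≤ (f≤g here) (∑∈-mono A (f≤g ∘ there))
∑∈-mono (outside ∷ A) f≤g = ∑∈-mono A (f≤g ∘ there)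

∑∈-χ : ∀ (A e : Subset n) k → ∑∈ A (λ v → χ e v ℕ.* k) ≡ ∣ e ∩ A ∣ ℕ.* k
∑∈-χ []            []          k = refl
∑∈-χ (inside  ∷ A) (true  ∷ e) k = cong₂ ℕ._+_ (ℕ.*-identityˡ k) (∑∈-χ A e k)
∑∈-χ (inside  ∷ A) (false ∷ e) k = ∑∈-χ A e k
∑∈-χ (outside ∷ A) (true  ∷ e) k = ∑∈-χ A e k
∑∈-χ (outside ∷ A) (false ∷ e) k = ∑∈-χ A e k

∑∈-∑-swap : ∀ {a} {X : Set a} (A : Subset n) (xs : List X) (F : X → Fin n → ℕ) →
  ∑∈ A (λ v → ∑ xs (λ x → F x v)) ≡ ∑ xs (λ x → ∑∈ A (F x))
∑∈-∑-swap []            xs F = sym (∑-const xs 0)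
∑∈-∑-swap (inside  ∷ A) xs F =
  trans (cong (∑ xs (λ x → F x zero) ℕ.+_) (∑∈-∑-swap A xs (λ x → F x ∘ suc)))
        (sym (∑-+ xs _ _))
∑∈-∑-swap (outside ∷ A) xs F = ∑∈-∑-swap A xs (λ x → F x ∘ suc)

-- Double counting of incident pairs: the weight of an edge is collected once for each of its
-- vertices in `A`.
∑∈-∑-χ : ∀ (A : Subset n) es (k : Subset n → ℕ) →
  ∑∈ A (λ v → ∑ es (λ e → χ e v ℕ.* k e)) ≡ ∑ es (λ e → ∣ e ∩ A ∣ ℕ.* k e)
∑∈-∑-χ A es k = trans (∑∈-∑-swap A es _) (∑-cong es λ e → ∑∈-χ A e (k e))

length-filter-nonempty : ∀ {n} (A : Subset n) es →
  length (filter (λ e → nonempty? (e ∩ A)) es) ≡ ∑ es (λ e → pos ∣ e ∩ A ∣)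
length-filter-nonempty A [] = refl
length-filter-nonempty {n} A (e ∷ es) with nonempty? (e ∩ A)
... | yes (v , v∈) = cong₂ ℕ._+_ (sym (pos-positive (∈⇒0<∣∣ v∈))) (length-filter-nonempty A es)
  where
  pos-positive : ∀ {i} → 0 ℕ.< i → pos i ≡ 1
  pos-positive (s≤s _) = refl
... | no empty = cong₂ ℕ._+_
  (sym (cong pos (trans (cong ∣_∣ (Empty-unique empty)) (∣⊥∣≡0 n)))) (length-filter-nonempty A es)

-- With c, a, b the numbers of vertices of an edge in C, A, B.
edge-count : ∀ c a b → c ℕ.+ (a ℕ.+ b) ≡ 3 →
  4 ℕ.+ (a ℕ.* one a ℕ.+ b ℕ.* one b) ℕ.≤
  (pos a ℕ.+ pos b ℕ.+ pos c ℕ.+ 3 ℕ.* pos c) ℕ.+ (a ℕ.* null c ℕ.+ b ℕ.* null c)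
edge-count 0 0 _ refl = ℕ.≤ᵇ⇒≤ _ _ _
edge-count 0 1 _ refl = ℕ.≤ᵇ⇒≤ _ _ _
edge-count 0 2 _ refl = ℕ.≤ᵇ⇒≤ _ _ _
edge-count 0 3 _ refl = ℕ.≤ᵇ⇒≤ _ _ _
edge-count 0 (suc (suc (suc (suc _)))) _ ()
edge-count 1 0 _ refl = ℕ.≤ᵇ⇒≤ _ _ _
edge-count 1 1 _ refl = ℕ.≤ᵇ⇒≤ _ _ _
edge-count 1 2 _ refl = ℕ.≤ᵇ⇒≤ _ _ _
edge-count 1 (suc (suc (suc _))) _ ()
edge-count 2 0 _ refl = ℕ.≤ᵇ⇒≤ _ _ _
edge-count 2 1 _ refl = ℕ.≤ᵇ⇒≤ _ _ _
edge-count 2 (suc (suc _)) _ ()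
edge-count 3 0 _ refl = ℕ.≤ᵇ⇒≤ _ _ _
edge-count 3 (suc _) _ ()
edge-count (suc (suc (suc (suc _)))) _ _ ()

-- Losses, gains and stability

module _ {n : ℕ} (H : Hypergraph n) where

  -- For `v` in `X`, `loss X v` is the drop of `d H X` when `v` leaves (`d-remove`); for `v`
  -- outside, `gain X v` is its rise when `v` enters (`d-insert`).
  loss gain : Subset n → Fin n → ℕ
  loss X v = ∑ (edges H) (λ e → χ e v ℕ.* one  ∣ e ∩ X ∣)
  gain X v = ∑ (edges H) (λ e → χ e v ℕ.* null ∣ e ∩ X ∣)

  d-∑ : ∀ X → d H X ≡ ∑ (edges H) (λ e → pos ∣ e ∩ X ∣)
  d-∑ X = length-filter-nonempty X (edges H)

  d≤m : ∀ X → d H X ℕ.≤ m H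
  d≤m X = length-filter _ (edges H)

  d-remove : v ∈ A → d H A ≡ loss A v ℕ.+ d H (A [ v ]≔ outside)
  d-remove {v} {A} v∈A = begin
    d H A ≡⟨ d-∑ A ⟩
    ∑ (edges H) (λ e → pos ∣ e ∩ A ∣) ≡⟨ ∑-cong (edges H) split ⟩
    ∑ (edges H) (λ e → χ e v ℕ.* one ∣ e ∩ A ∣ ℕ.+ pos ∣ e ∩ (A [ v ]≔ outside) ∣)
      ≡⟨ ∑-+ (edges H) _ _ ⟩
    loss A v ℕ.+ ∑ (edges H) (λ e → pos ∣ e ∩ (A [ v ]≔ outside) ∣)
      ≡⟨ cong (loss A v ℕ.+_) (d-∑ (A [ v ]≔ outside)) ⟨
    loss A v ℕ.+ d H (A [ v ]≔ outside) ∎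
    where
    open ≡-Reasoning
    split : ∀ e → pos ∣ e ∩ A ∣ ≡ χ e v ℕ.* one ∣ e ∩ A ∣ ℕ.+ pos ∣ e ∩ (A [ v ]≔ outside) ∣
    split e rewrite ∣∩∣-remove e v∈A = pos-χ+≡one e v _

  d-insert : v ∉ C → d H (C [ v ]≔ inside) ≡ gain C v ℕ.+ d H C
  d-insert {v} {C} v∉C = begin
    d H (C [ v ]≔ inside) ≡⟨ d-∑ _ ⟩
    ∑ (edges H) (λ e → pos ∣ e ∩ (C [ v ]≔ inside) ∣)
      ≡⟨ ∑-cong (edges H) (λ e → trans (cong pos (∣∩∣-insert e v∉C)) (pos-χ+≡null e v _)) ⟩
    ∑ (edges H) (λ e → χ e v ℕ.* null ∣ e ∩ C ∣ ℕ.+ pos ∣ e ∩ C ∣) ≡⟨ ∑-+ (edges H) _ _ ⟩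
    gain C v ℕ.+ ∑ (edges H) (λ e → pos ∣ e ∩ C ∣) ≡⟨ cong (gain C v ℕ.+_) (d-∑ C) ⟨
    gain C v ℕ.+ d H C ∎
    where open ≡-Reasoning

  -- An edge through `v` whose only vertex in `B` is `v` also has `v` as its only vertex in `A`,
  -- because `v` has stayed in `A`.
  loss-antitone : A ⊆ B → v ∈ A → loss B v ℕ.≤ loss A v
  loss-antitone {A} {B} {v} A⊆B v∈A = ∑-mono (All.universal pointwise (edges H))
    where
    pointwise : ∀ e → χ e v ℕ.* one ∣ e ∩ B ∣ ℕ.≤ χ e v ℕ.* one ∣ e ∩ A ∣
    pointwise e with lookup e v in v∈e
    ... | false = z≤n
    ... | true  = ℕ.*-monoʳ-≤ 1 (one-antitone (∈⇒0<∣∣ (x∈p∩q⁺ (lookup⇒[]= v e v∈e , v∈A)))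
                                              (p⊆q⇒∣p∣≤∣q∣ (∩-monoʳ-⊆ e A⊆B)))

  gain-antitone : A ⊆ B → ∀ v → gain B v ℕ.≤ gain A v
  gain-antitone A⊆B v = ∑-mono (All.universal
    (λ e → ℕ.*-monoʳ-≤ (χ e v) (null-antitone (p⊆q⇒∣p∣≤∣q∣ (∩-monoʳ-⊆ e A⊆B)))) (edges H))

  -- Moving `v` from `A` to `C` leaves the third part alone, so this inequality says exactly that
  -- `S` does not rise.
  Stable : Subset n → Subset n → Set
  Stable A C = ∀ {v} → v ∈ A → gain C v ℕ.≤ loss A v

  Stable-⊆ : ∀ {A′ C′} → A′ ⊆ A → C ⊆ C′ → Stable A C → Stable A′ C′
  Stable-⊆ A′⊆A C⊆C′ stable {v} v∈A′ = ℕ.≤-trans (gain-antitone C⊆C′ v)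
    (ℕ.≤-trans (stable (A′⊆A v∈A′)) (loss-antitone A′⊆A v∈A′))

  S : Subset n → Subset n → Subset n → ℕ
  S A B C = d H A ℕ.+ d H B ℕ.+ d H C

  S-swap₁₂ : ∀ A B C → S A B C ≡ S B A C
  S-swap₁₂ A B C = cong (ℕ._+ d H C) (ℕ.+-comm (d H A) (d H B))

  S-swap₂₃ : ∀ A B C → S A B C ≡ S A C B
  S-swap₂₃ A B C = solve 3 (λ a b c → a :+ b :+ c := a :+ c :+ b) refl (d H A) (d H B) (d H C)
    where open +-*-Solver

  -- The ceiling that makes the hill climbing end.
  S≤3m : ∀ A B C → S A B C ℕ.≤ 3 ℕ.* m H
  S≤3m A B C = ℕ.≤-trans (ℕ.+-mono-≤ (ℕ.+-mono-≤ (d≤m A) (d≤m B)) (d≤m C))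
    (ℕ.≤-reflexive (solve 1 (λ k → k :+ k :+ k := con 3 :* k) refl (m H)))
    where open +-*-Solver

  stable-count : Partition A B C → Stable A C → Stable B C →
    4 ℕ.* m H ℕ.≤ S A B C ℕ.+ 3 ℕ.* d H C
  -- The total loss is added to both sides and cancelled at the end, which avoids subtraction in ℕ.
  stable-count {A} {B} {C} π stableA stableB = ℕ.+-cancelʳ-≤ losses _ _ (begin
    4 ℕ.* m H ℕ.+ losses
      ≡⟨ cong₂ ℕ._+_ (sym (∑-const es 4)) (collect (λ e → one ∣ e ∩ A ∣) (λ e → one ∣ e ∩ B ∣)) ⟩
    ∑ es (λ _ → 4) ℕ.+ ∑ es (λ e → ∣ e ∩ A ∣ ℕ.* one ∣ e ∩ A ∣ ℕ.+ ∣ e ∩ B ∣ ℕ.* one ∣ e ∩ B ∣)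
      ≡⟨ ∑-+ es _ _ ⟨
    ∑ es (λ e → 4 ℕ.+ (∣ e ∩ A ∣ ℕ.* one ∣ e ∩ A ∣ ℕ.+ ∣ e ∩ B ∣ ℕ.* one ∣ e ∩ B ∣))
      -- The bound for a single edge is tight, except for an edge with one vertex in `C` and the
      -- other two together in `A` or together in `B`, where it has slack 1.
      ≤⟨ ∑-mono (All.map (λ {e} ∣e∣≡3 → edge-count (∣ e ∩ C ∣) (∣ e ∩ A ∣) (∣ e ∩ B ∣)
                            (trans (∣∩∣-partition e π) ∣e∣≡3)) (uniform3 H)) ⟩
    ∑ es (λ e → (h A e ℕ.+ h B e ℕ.+ h C e ℕ.+ 3 ℕ.* h C e) ℕ.+
                (∣ e ∩ A ∣ ℕ.* null ∣ e ∩ C ∣ ℕ.+ ∣ e ∩ B ∣ ℕ.* null ∣ e ∩ C ∣))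
      ≡⟨ ∑-+ es _ _ ⟩
    ∑ es (λ e → h A e ℕ.+ h B e ℕ.+ h C e ℕ.+ 3 ℕ.* h C e) ℕ.+
    ∑ es (λ e → ∣ e ∩ A ∣ ℕ.* null ∣ e ∩ C ∣ ℕ.+ ∣ e ∩ B ∣ ℕ.* null ∣ e ∩ C ∣)
      ≡⟨ cong₂ ℕ._+_ degrees (sym (collect _ _)) ⟩
    S A B C ℕ.+ 3 ℕ.* d H C ℕ.+ gains
      -- Stability enters here, summed over all vertices of `A` and `B`.
      ≤⟨ ℕ.+-monoʳ-≤ (S A B C ℕ.+ 3 ℕ.* d H C)
           (ℕ.+-mono-≤ (∑∈-mono A stableA) (∑∈-mono B stableB)) ⟩
    S A B C ℕ.+ 3 ℕ.* d H C ℕ.+ losses ∎)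
    where
    open ℕ.≤-Reasoning
    es = edges H
    losses gains : ℕ
    losses = ∑∈ A (loss A) ℕ.+ ∑∈ B (loss B)
    gains  = ∑∈ A (gain C) ℕ.+ ∑∈ B (gain C)
    h : Subset n → Subset n → ℕ
    h X e = pos ∣ e ∩ X ∣
    collect : ∀ (j k : Subset n → ℕ) →
      ∑∈ A (λ v → ∑ es (λ e → χ e v ℕ.* j e)) ℕ.+ ∑∈ B (λ v → ∑ es (λ e → χ e v ℕ.* k e)) ≡
      ∑ es (λ e → ∣ e ∩ A ∣ ℕ.* j e ℕ.+ ∣ e ∩ B ∣ ℕ.* k e)
    collect j k = trans (cong₂ ℕ._+_ (∑∈-∑-χ A es j) (∑∈-∑-χ B es k)) (sym (∑-+ es _ _))
    degrees : ∑ es (λ e → h A e ℕ.+ h B e ℕ.+ h C e ℕ.+ 3 ℕ.* h C e) ≡ S A B C ℕ.+ 3 ℕ.* d H C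
    degrees rewrite d-∑ A | d-∑ B | d-∑ C
      | ∑-+ es (λ e → h A e ℕ.+ h B e ℕ.+ h C e) (λ e → 3 ℕ.* h C e)
      | ∑-+ es (λ e → h A e ℕ.+ h B e) (h C) | ∑-+ es (h A) (h B) | ∑-* es 3 (h C) = refl

  -- Hill climbing on `S`

  Improves : ℕ → Set
  Improves s = ∃[ A ] ∃[ B ] ∃[ C ] (Partition A B C × s ℕ.< S A B C)

  stable-or-improves : Partition A B C → Stable A C ⊎ Improves (S A B C)
  stable-or-improves {A} {B} {C} π with any? (λ v → v ∈? A ×-dec (loss A v ℕ.<? gain C v))
  ... | no ∄v = inj₁ λ {v} v∈A → ℕ.≮⇒≥ λ loss<gain → ∄v (v , v∈A , loss<gain)
  ... | yes (v , v∈A , loss<gain) = inj₂ (A⁻ , B , C⁺ , move₁₃ π v∈A , (begin-strict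
    d H A ℕ.+ d H B ℕ.+ d H C
      ≡⟨ cong (λ a → a ℕ.+ d H B ℕ.+ d H C) (d-remove v∈A) ⟩
    loss A v ℕ.+ d H A⁻ ℕ.+ d H B ℕ.+ d H C
      <⟨ ℕ.+-monoˡ-< (d H C) (ℕ.+-monoˡ-< (d H B) (ℕ.+-monoˡ-< (d H A⁻) loss<gain)) ⟩
    gain C v ℕ.+ d H A⁻ ℕ.+ d H B ℕ.+ d H C
      ≡⟨ solve 4 (λ g a b c → g :+ a :+ b :+ c := a :+ b :+ (g :+ c)) refl
           (gain C v) (d H A⁻) (d H B) (d H C) ⟩
    d H A⁻ ℕ.+ d H B ℕ.+ (gain C v ℕ.+ d H C)
      ≡⟨ cong (d H A⁻ ℕ.+ d H B ℕ.+_) (d-insert (disjoint₁₃ π v∈A)) ⟨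
    d H A⁻ ℕ.+ d H B ℕ.+ d H C⁺ ∎))
    where
    open ℕ.≤-Reasoning
    open +-*-Solver
    A⁻ = A [ v ]≔ outside
    C⁺ = C [ v ]≔ inside

  StableWithBad : (Subset n → Set) → Set
  StableWithBad P = ∃[ A ] ∃[ B ] ∃[ C ] (Partition A B C × ¬ P C × Stable A C × Stable B C)

  module _ {P : Subset n → Set} (P? : Decidable P)
           (noPartition : ∀ {A B C} → Partition A B C → P A → P B → ¬ P C) where

    step-bad : Partition A B C → ¬ P C → StableWithBad P ⊎ Improves (S A B C)
    -- The test covers moves out of the first part only, so it runs a second time with `A` and `B`
    -- exchanged.
    step-bad {A} {B} {C} π ¬PC with stable-or-improves π | stable-or-improves (swap₁₂ π)
    ... | inj₂ improves | _ = inj₂ improves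
    ... | inj₁ _ | inj₂ improves = inj₂ (subst Improves (S-swap₁₂ B A C) improves)
    ... | inj₁ stableA | inj₁ stableB = inj₁ (A , B , C , π , ¬PC , stableA , stableB)

    -- Some part fails `P`, by `noPartition`. It is renamed to be the third part, which the symmetry
    -- of `S` permits; a different part may fail after each improvement.
    step : Partition A B C → StableWithBad P ⊎ Improves (S A B C)
    step {A} {B} {C} π with P? C | P? B | P? A
    ... | no ¬PC | _ | _ = step-bad π ¬PC
    ... | yes _ | no ¬PB | _ =
      subst (λ s → StableWithBad P ⊎ Improves s) (S-swap₂₃ A C B) (step-bad (swap₂₃ π) ¬PB)
    ... | yes _ | yes _ | no ¬PA =
      subst (λ s → StableWithBad P ⊎ Improves s)
        (trans (S-swap₂₃ B C A) (S-swap₁₂ B A C)) (step-bad (swap₂₃ (swap₁₂ π)) ¬PA)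
    ... | yes PC | yes PB | yes PA = contradiction PC (noPartition π PA PB)

    ∃-stable : StableWithBad P
    -- Any partition could serve as the start; the measure is the distance of `S` from its ceiling
    -- `3 ℕ.* m H`.
    ∃-stable = climb (trivialPartition n) (<-wellFounded _)
      where
      climb : Partition A B C → Acc ℕ._<_ (3 ℕ.* m H ℕ.∸ S A B C) → StableWithBad P
      climb π (acc rec) with step π
      ... | inj₁ stable = stable
      ... | inj₂ (A′ , B′ , C′ , π′ , S<S′) =
        climb π′ (rec (ℕ.∸-monoʳ-< S<S′ (S≤3m A′ B′ C′)))

-- Rational estimates

-- `+ k / 1` runs through a gcd normalisation that is stuck for a variable `k`, whereas `fromℤ`
-- exposes numerator and denominator.
ℕ→ℚ≡fromℤ : ∀ k → ℕ→ℚ k ≡ fromℤ (+ k)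
ℕ→ℚ≡fromℤ k = ℚ.↥p/↧p≡p (fromℤ (+ k))

ℕ→ℚ-mono : ∀ {j k} → j ℕ.≤ k → ℕ→ℚ j ≤ ℕ→ℚ k
ℕ→ℚ-mono {j} {k} j≤k rewrite ℕ→ℚ≡fromℤ j | ℕ→ℚ≡fromℤ k =
  *≤* (ℤ.*-monoʳ-≤-nonNeg (+ 1) (ℤ.+≤+ j≤k))

ℕ→ℚ-+ : ∀ j k → ℕ→ℚ (j ℕ.+ k) ≡ ℕ→ℚ j + ℕ→ℚ k
ℕ→ℚ-+ j k rewrite ℕ→ℚ≡fromℤ j | ℕ→ℚ≡fromℤ k =
  sym (cong (_/ 1) (cong₂ ℤ._+_ (ℤ.*-identityʳ (+ j)) (ℤ.*-identityʳ (+ k))))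

ℕ→ℚ-* : ∀ j k → ℕ→ℚ (j ℕ.* k) ≡ ℕ→ℚ j * ℕ→ℚ k
ℕ→ℚ-* j k rewrite ℕ→ℚ≡fromℤ j | ℕ→ℚ≡fromℤ k = cong (_/ 1) (ℤ.pos-* j k)

threshold : ℚ → ℚ
threshold ε = (+ 2 / 3) - ε

surplus : ℚ → ℚ
surplus ε = (+ 2 / 1) + (+ 3 / 1) * ε

-- The constant comes from 4 - 3(2/3 - ε) = 2 + 3ε.
surplus-< : ∀ {ε M s x} → x < threshold ε * M → (+ 4 / 1) * M ≤ s + (+ 3 / 1) * x →
  surplus ε * M < s
surplus-< {ε} {M} {s} {x} x<tM 4M≤s+3x = begin-strict
  surplus ε * M
    ≡⟨ solve 2 (λ e k → (con (+ 2 / 1) :+ con (+ 3 / 1) :* e) :* k :=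
         con (+ 4 / 1) :* k :+ con (- (+ 3 / 1)) :* ((con (+ 2 / 3) :- e) :* k)) refl ε M ⟩
  (+ 4 / 1) * M + (- (+ 3 / 1)) * (threshold ε * M)
    <⟨ ℚ.+-mono-≤-< 4M≤s+3x (ℚ.*-monoʳ-<-neg (- (+ 3 / 1)) x<tM) ⟩
  s + (+ 3 / 1) * x + (- (+ 3 / 1)) * x
    ≡⟨ solve 2 (λ p q → p :+ con (+ 3 / 1) :* q :+ con (- (+ 3 / 1)) :* q := p) refl s x ⟩
  s ∎
  where
  open ℚ.≤-Reasoning
  open ℚ.+-*-Solver

<-surplus : ∀ {ε M x y z} → (+ 1 / 15) ≤ ε → ℕ→ℚ 0 ≤ M →
  x < threshold ε * M → y < threshold ε * M → z ≤ M → x + y + z < surplus ε * M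
<-surplus {ε} {M} {x} {y} {z} 1/15≤ε 0≤M x< y< z≤ = begin-strict
  x + y + z
    <⟨ ℚ.+-mono-<-≤ (ℚ.+-mono-< x< y<) z≤ ⟩
  threshold ε * M + threshold ε * M + M
    -- The coefficient 2(2/3 - ε) + 1 is 2 + 1/3 - 2ε. Writing 1/3 as 5 · 1/15 lets the lower bound
    -- on ε turn it into at most 2 + 5ε - 2ε.
    ≡⟨ solve 2 (λ e k → (con (+ 2 / 3) :- e) :* k :+ (con (+ 2 / 3) :- e) :* k :+ k :=
         (con (+ 2 / 1) :+ con (+ 5 / 1) :* con (+ 1 / 15) :+ con (- (+ 2 / 1)) :* e) :* k)
         refl ε M ⟩
  ((+ 2 / 1) + (+ 5 / 1) * (+ 1 / 15) + (- (+ 2 / 1)) * ε) * M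
    ≤⟨ ℚ.*-monoʳ-≤-nonNeg M {{nonNegative 0≤M}}
         (ℚ.+-monoˡ-≤ ((- (+ 2 / 1)) * ε)
           (ℚ.+-monoʳ-≤ (+ 2 / 1) (ℚ.*-monoˡ-≤-nonNeg (+ 5 / 1) 1/15≤ε))) ⟩
  ((+ 2 / 1) + (+ 5 / 1) * ε + (- (+ 2 / 1)) * ε) * M
    ≡⟨ solve 2 (λ e k → (con (+ 2 / 1) :+ con (+ 5 / 1) :* e :+ con (- (+ 2 / 1)) :* e) :* k :=
         (con (+ 2 / 1) :+ con (+ 3 / 1) :* e) :* k) refl ε M ⟩
  surplus ε * M ∎
  where
  open ℚ.≤-Reasoning
  open ℚ.+-*-Solver

-- From stability to the required partition

module _ {n : ℕ} (H : Hypergraph n) (ε : ℚ) where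

  good? : Decidable (Good H ε)
  good? X = _ ℚ.≤? _

  stable-surplus : Partition A B C → Bad H ε C → Stable H A C → Stable H B C →
    surplus ε * ℕ→ℚ (m H) < ℕ→ℚ (d H A) + ℕ→ℚ (d H B) + ℕ→ℚ (d H C)
  stable-surplus {A} {B} {C} π badC stableA stableB = surplus-< {ε} (ℚ.≰⇒> badC)
    (subst₂ _≤_ (ℕ→ℚ-* 4 (m H)) cast (ℕ→ℚ-mono (stable-count H π stableA stableB)))
    where
    a = d H A
    b = d H B
    c = d H C
    cast : ℕ→ℚ (a ℕ.+ b ℕ.+ c ℕ.+ 3 ℕ.* c) ≡ ℕ→ℚ a + ℕ→ℚ b + ℕ→ℚ c + (+ 3 / 1) * ℕ→ℚ c
    cast = trans (ℕ→ℚ-+ (a ℕ.+ b ℕ.+ c) (3 ℕ.* c))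
      (cong₂ _+_ (trans (ℕ→ℚ-+ (a ℕ.+ b) c) (cong (_+ ℕ→ℚ c) (ℕ→ℚ-+ a b))) (ℕ→ℚ-* 3 c))

  stable-good : (+ 1 / 15) ≤ ε → Partition A B C → Bad H ε C → Stable H A C → Stable H B C →
    Good H ε A
  stable-good {A} {B} {C} 1/15≤ε π badC stableA stableB with good? A
  ... | yes goodA = goodA
  ... | no badA = contradiction refl (ℚ.<⇒≢ (ℚ.<-trans
    -- The sum is reordered so that the two bad sets come first, as `<-surplus` expects; the
    -- remaining degree is bounded by `m H`.
    (subst (surplus ε * M <_) (swap-last a b c) (stable-surplus π badC stableA stableB))
    (<-surplus {ε} {M} {a} {c} {b} 1/15≤ε (ℕ→ℚ-mono {0} {m H} z≤n) (ℚ.≰⇒> badA) (ℚ.≰⇒> badC)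
      (ℕ→ℚ-mono {d H B} {m H} (d≤m H B)))))
    where
    M = ℕ→ℚ (m H)
    a = ℕ→ℚ (d H A)
    b = ℕ→ℚ (d H B)
    c = ℕ→ℚ (d H C)
    swap-last : ∀ a b c → a + b + c ≡ a + c + b
    swap-last = solve 3 (λ a b c → a :+ b :+ c := a :+ c :+ b) refl
      where open ℚ.+-*-Solver

theorem1 : (n : ℕ) (H : Hypergraph n) (ε : ℚ) →
    (+ 1 / 15) ≤ ε → ε < (+ 2 / 3) →
    ¬ (∃[ A ] ∃[ B ] ∃[ C ] (IsPartition A B C × Good H ε A × Good H ε B × Good H ε C)) →
    ∃[ A ] ∃[ B ] ∃[ C ] (IsPartition A B C × MinimalGood H ε A × MinimalGood H ε B ×
    ((+ 2 / 1) + (+ 3 / 1) * ε) * ℕ→ℚ (m H) < (ℕ→ℚ (d H A) + ℕ→ℚ (d H B)) + ℕ→ℚ (d H C))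
theorem1 n H ε 1/15≤ε _ noGood =
  let noGood′ = λ {A B C} (π : Partition A B C) gA gB gC →
        noGood (A , B , C , Partition⇒IsPartition π , gA , gB , gC)
      A , B , C , π , badC , stableA , stableB = ∃-stable H (good? H ε) noGood′
      goodA = stable-good H ε 1/15≤ε π badC stableA stableB
      goodB = stable-good H ε 1/15≤ε (swap₁₂ π) badC stableB stableA
      A′ , A′⊆A , minA = ∃-minimal (good? H ε) A goodA
      B′ , B′⊆B , minB = ∃-minimal (good? H ε) B goodB
      C′ , C⊆C′ , π′ = shrink π A′⊆A B′⊆B
  in  A′ , B′ , C′ , Partition⇒IsPartition π′ , minA , minB ,
      -- Shrinking may lower `S`, so the bound is not inherited but derived afresh: `C′` is bad
      -- because `A′` and `B′` are good, and stability has survived.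
      stable-surplus H ε π′ (noGood′ π′ (proj₁ minA) (proj₁ minB))
        (Stable-⊆ H A′⊆A C⊆C′ stableA) (Stable-⊆ H B′⊆B C⊆C′ stableB)
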